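{- Let $(X,+)$ be an uncountable abelian Polish group with a complete metric $d$. Let $\mathcal I\subseteq\mathcal P(X)$ be a proper, translation-invariant $\sigma$-ideal containing singletons and having a Borel base, such that for every Borel set $B\notin\mathcal I$ and every family $\mathcal D\subseteq\mathcal I$ with $|\mathcal D|<\mathfrak c$ we have $|B\setminus\bigcup\mathcal D|=\mathfrak c$, and such that there is $a$ in the range of $d$, $a\ne0$, with $\{y\in X:d(x,y)=a\}\in\mathcal I$ for every $x\in X$. If $2^\kappa\le\mathfrak c$ for every cardinal $\kappa<\mathfrak c$, then there exists a family $\{B_\xi:\xi<\mathfrak c\}$ of pairwise disjoint subsets of $X$ such that (1) every $B_\xi$ is completely $\mathcal I$-nonmeasurable, (2) no $B_\xi$ is a $2$-covering, and (3) $\{B_\xi:\xi<\mathfrak c\}$ is a ${<}\mathfrak c$-S-covering.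
   Context: $\mathfrak c=|\mathbb R|$. A set $N\subseteq X$ is completely $\mathcal I$-nonmeasurable if for every Borel $A\notin\mathcal I$ both $A\cap N\notin\mathcal I$ and $A\setminus N\notin\mathcal I$. A set $A\subseteq X$ is a $2$-covering if for every $C\subseteq X$ with $|C|=2$ there is $x\in X$ with $C+x\subseteq A$. A family $\mathcal A$ of pairwise disjoint subsets of $X$ is a ${<}\kappa$-S-covering if for every $F\subseteq X$ with $|F|<\kappa$ there is $t\in X$ such that $F+t\subseteq\bigcup\mathcal A$ and $|(F+t)\cap A|\le1$ for all $A\in\mathcal A$. -}

module Defs where

open import Algebra.Bundles using (AbelianGroup)
open import Data.Bool.Properties using () renaming (≡-setoid to Bool-setoid)
open import Data.Empty using (⊥)
open import Data.Fin.Base using (Fin)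
open import Data.Nat.Base using (ℕ) renaming (_≤_ to _≤ⁿ_; _⊔_ to _⊔ⁿ_)
import Data.Nat.Properties as ℕ
open import Data.Product.Base using (Σ; ∃; ∃-syntax; _×_; _,_; proj₁; proj₂; swap)
open import Data.Rational.Base as ℚ using (ℚ; 0ℚ; ½; ∣_∣)
import Data.Rational.Properties as ℚ
open import Data.Rational.Solver using (module +-*-Solver)
open import Data.Unit.Base using (⊤)
open import Function.Bundles using (Func; _⟨$⟩_; Injection; Bijection)
import Function.Metric.Structures as Metric
open import Function.Relation.Binary.Setoid.Equality using (_⇨_)
open import Level using (Level; 0ℓ) renaming (suc to lsuc; _⊔_ to _⊔ˡ_)
open import Relation.Binary.Bundles using (Setoid)
import Relation.Binary.Construct.On as On
open import Relation.Binary.Definitions using (_Respects_)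
open import Relation.Binary.PropositionalEquality
  using (_≡_; refl; sym; trans; cong; subst) renaming (setoid to ≡-setoid)
open import Relation.Binary.Structures using (IsPartialOrder)
open import Relation.Nullary.Negation using (¬_)
open import Relation.Unary using (Pred)

private
  variable
    a b ℓ₁ ℓ₂ i : Level

------------------------------------------------------------------------
-- Real numbers: Cauchy sequences of rationals.  No modulus is recorded,
-- and real numbers are compared by _≈ᴿ_, never by _≡_.

record ℝ : Set where
  constructor mkℝ
  field
    seq    : ℕ → ℚ
    cauchy : ∀ ε → 0ℚ ℚ.< ε →
             ∃[ N ] ∀ m n → N ≤ⁿ m → N ≤ⁿ n → ∣ seq m ℚ.- seq n ∣ ℚ.< ε

open ℝ public

infix 4 _≤ᴿ_ _<ᴿ_ _≈ᴿ_
infixl 6 _+ᴿ_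

_≤ᴿ_ : ℝ → ℝ → Set
x ≤ᴿ y = ∀ ε → 0ℚ ℚ.< ε → ∃[ N ] ∀ n → N ≤ⁿ n → seq x n ℚ.≤ seq y n ℚ.+ ε

_<ᴿ_ : ℝ → ℝ → Set
x <ᴿ y = ∃[ ε ] 0ℚ ℚ.< ε × ∃[ N ] ∀ n → N ≤ⁿ n → seq x n ℚ.+ ε ℚ.≤ seq y n

_≈ᴿ_ : ℝ → ℝ → Set
x ≈ᴿ y = x ≤ᴿ y × y ≤ᴿ x

0ᴿ : ℝ
0ᴿ = mkℝ (λ _ → 0ℚ) (λ ε 0<ε → 0 , λ _ _ _ _ → 0<ε)

private
  halves : ∀ ε → ε ℚ.* ½ ℚ.+ ε ℚ.* ½ ≡ ε
  halves ε = trans (sym (ℚ.*-distribˡ-+ ε ½ ½)) (ℚ.*-identityʳ ε)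

  0<half : ∀ {ε} → 0ℚ ℚ.< ε → 0ℚ ℚ.< ε ℚ.* ½
  0<half {ε} 0<ε = subst (ℚ._< ε ℚ.* ½) (ℚ.*-zeroˡ ½) (ℚ.*-monoˡ-<-pos ½ 0<ε)

  interchange : ∀ p q r s → (p ℚ.+ q) ℚ.- (r ℚ.+ s) ≡ (p ℚ.- r) ℚ.+ (q ℚ.- s)
  interchange = solve 4 (λ p q r s →
    (p :+ q) :- (r :+ s) := (p :- r) :+ (q :- s)) refl
    where open +-*-Solver

  ≤ᴿ-refl : ∀ {x} → x ≤ᴿ x
  ≤ᴿ-refl {x} ε 0<ε = 0 , λ n _ →
    subst (ℚ._≤ seq x n ℚ.+ ε) (ℚ.+-identityʳ (seq x n))
          (ℚ.+-monoʳ-≤ (seq x n) (ℚ.<⇒≤ 0<ε))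

  ≤ᴿ-trans : ∀ {x y z} → x ≤ᴿ y → y ≤ᴿ z → x ≤ᴿ z
  ≤ᴿ-trans {x} {y} {z} x≤y y≤z ε 0<ε
    with x≤y (ε ℚ.* ½) (0<half 0<ε) | y≤z (ε ℚ.* ½) (0<half 0<ε)
  ... | M , p | N , q = M ⊔ⁿ N , λ n M⊔N≤n → begin
    seq x n                              ≤⟨ p n (ℕ.m⊔n≤o⇒m≤o M N M⊔N≤n) ⟩
    seq y n ℚ.+ ε ℚ.* ½                  ≤⟨ ℚ.+-monoˡ-≤ (ε ℚ.* ½) (q n (ℕ.m⊔n≤o⇒n≤o M N M⊔N≤n)) ⟩
    seq z n ℚ.+ ε ℚ.* ½ ℚ.+ ε ℚ.* ½      ≡⟨ ℚ.+-assoc (seq z n) (ε ℚ.* ½) (ε ℚ.* ½) ⟩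
    seq z n ℚ.+ (ε ℚ.* ½ ℚ.+ ε ℚ.* ½)    ≡⟨ cong (seq z n ℚ.+_) (halves ε) ⟩
    seq z n ℚ.+ ε                        ∎
    where open ℚ.≤-Reasoning

_+ᴿ_ : ℝ → ℝ → ℝ
seq (x +ᴿ y) n = seq x n ℚ.+ seq y n
cauchy (x +ᴿ y) ε 0<ε
  with cauchy x (ε ℚ.* ½) (0<half 0<ε) | cauchy y (ε ℚ.* ½) (0<half 0<ε)
... | M , p | N , q = M ⊔ⁿ N , λ m n l k → begin-strict
  ∣ (seq x m ℚ.+ seq y m) ℚ.- (seq x n ℚ.+ seq y n) ∣
    ≡⟨ cong ∣_∣ (interchange (seq x m) (seq y m) (seq x n) (seq y n)) ⟩
  ∣ (seq x m ℚ.- seq x n) ℚ.+ (seq y m ℚ.- seq y n) ∣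
    ≤⟨ ℚ.∣p+q∣≤∣p∣+∣q∣ (seq x m ℚ.- seq x n) (seq y m ℚ.- seq y n) ⟩
  ∣ seq x m ℚ.- seq x n ∣ ℚ.+ ∣ seq y m ℚ.- seq y n ∣
    <⟨ ℚ.+-mono-< (p m n (ℕ.m⊔n≤o⇒m≤o M N l) (ℕ.m⊔n≤o⇒m≤o M N k))
                  (q m n (ℕ.m⊔n≤o⇒n≤o M N l) (ℕ.m⊔n≤o⇒n≤o M N k)) ⟩
  ε ℚ.* ½ ℚ.+ ε ℚ.* ½
    ≡⟨ halves ε ⟩
  ε ∎
  where open ℚ.≤-Reasoning

≤ᴿ-isPartialOrder : IsPartialOrder _≈ᴿ_ _≤ᴿ_
≤ᴿ-isPartialOrder = record
  { isPreorder = record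
    { isEquivalence = record
      { refl  = λ {x} → ≤ᴿ-refl {x} , ≤ᴿ-refl {x}
      ; sym   = swap
      ; trans = λ {x} {y} {z} (x≤y , y≤x) (y≤z , z≤y) →
          ≤ᴿ-trans {x} {y} {z} x≤y y≤z , ≤ᴿ-trans {z} {y} {x} z≤y y≤x
      }
    ; reflexive = proj₁
    ; trans     = λ {x} {y} {z} → ≤ᴿ-trans {x} {y} {z}
    }
  ; antisym = _,_
  }

ℝ-setoid : Setoid 0ℓ 0ℓ
ℝ-setoid = record { isEquivalence = IsPartialOrder.isEquivalence ≤ᴿ-isPartialOrder }

------------------------------------------------------------------------
-- Cardinalities.  A set is a setoid; 𝔠 is the cardinality of ℝ-setoid.
--
-- These are the usual cardinal comparisons when read classically: excluded
-- middle for all types provides a choice operator, which together with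
-- function extensionality (applied to characteristic functions into Bool)
-- picks representatives of equivalence classes, i.e. gives the axiom of
-- choice for setoids.

infix 4 _≲_ _≺_ _≃_

_≲_ : Setoid a ℓ₁ → Setoid b ℓ₂ → Set (a ⊔ˡ b ⊔ˡ ℓ₁ ⊔ˡ ℓ₂)
S ≲ T = Injection S T

_≺_ : Setoid a ℓ₁ → Setoid b ℓ₂ → Set (a ⊔ˡ b ⊔ˡ ℓ₁ ⊔ˡ ℓ₂)
S ≺ T = S ≲ T × ¬ (T ≲ S)

_≃_ : Setoid a ℓ₁ → Setoid b ℓ₂ → Set (a ⊔ˡ b ⊔ˡ ℓ₁ ⊔ˡ ℓ₂)
S ≃ T = Bijection S T

Countable : Setoid a ℓ₁ → Set (a ⊔ˡ ℓ₁)
Countable S = S ≲ ≡-setoid ℕ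

-- Functions into Bool, that is, the power set 2^K.
2^ : Setoid 0ℓ 0ℓ → Setoid 0ℓ 0ℓ
2^ K = K ⇨ Bool-setoid

------------------------------------------------------------------------
-- Subsets of a setoid

record Subset (S : Setoid 0ℓ 0ℓ) : Set₁ where
  open Setoid S using (Carrier; _≈_)
  field
    pred : Pred Carrier 0ℓ
    resp : pred Respects _≈_

open Subset public

module _ {S : Setoid 0ℓ 0ℓ} where
  open Setoid S using (Carrier; _≈_) renaming (sym to ≈-sym; trans to ≈-trans)

  infix  4 _∈_ _⊆_
  infixl 7 _∩_
  infixl 6 _∖_

  _∈_ : Carrier → Subset S → Set
  x ∈ A = pred A x

  _⊆_ : Subset S → Subset S → Set
  A ⊆ B = ∀ {x} → x ∈ A → x ∈ B

  _∩_ : Subset S → Subset S → Subset S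
  pred (A ∩ B) x = x ∈ A × x ∈ B
  resp (A ∩ B) x≈y (x∈A , x∈B) = resp A x≈y x∈A , resp B x≈y x∈B

  _∖_ : Subset S → Subset S → Subset S
  pred (A ∖ B) x = x ∈ A × ¬ x ∈ B
  resp (A ∖ B) x≈y (x∈A , x∉B) =
    resp A x≈y x∈A , λ y∈B → x∉B (resp B (≈-sym x≈y) y∈B)

  ∁ : Subset S → Subset S
  pred (∁ A) x = ¬ x ∈ A
  resp (∁ A) x≈y x∉A y∈A = x∉A (resp A (≈-sym x≈y) y∈A)

  ⋃ : {J : Set} → (J → Subset S) → Subset S
  pred (⋃ A) x = ∃[ j ] x ∈ A j
  resp (⋃ A) x≈y (j , x∈Aj) = j , resp (A j) x≈y x∈Aj

  ｛_｝ : Carrier → Subset S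
  pred ｛ x ｝ y = y ≈ x
  resp ｛ x ｝ y≈z y≈x = ≈-trans (≈-sym y≈z) y≈x

  -- The set of members of A, whose equality is that of S.
  ⟦_⟧ : Subset S → Setoid 0ℓ 0ℓ
  ⟦ A ⟧ = On.setoid {B = ∃[ x ] x ∈ A} S proj₁

module _ (S : Setoid 0ℓ 0ℓ) where
  open Setoid S using (Carrier)

  ∅ : Subset S
  pred ∅ _ = ⊥
  resp ∅ _ ()

  full : Subset S
  pred full _ = ⊤
  resp full _ t = t

  Subsets : Setoid (lsuc 0ℓ) 0ℓ
  Subsets = record
    { Carrier       = Subset S
    ; _≈_           = λ A B → A ⊆ B × B ⊆ A
    ; isEquivalence = record
      { refl  = (λ z → z) , (λ z → z)
      ; sym   = swap
      ; trans = λ (p , q) (r , s) → (λ z → r (p z)) , (λ z → q (s z))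
      }
    }

-- A family {A_j : j ∈ J}.  A set of subsets having cardinality κ is
-- presented by such a family over a J of cardinality κ.
Family : Setoid 0ℓ 0ℓ → Setoid 0ℓ 0ℓ → Set₁
Family J S = Func J (Subsets S)

⋃ᶠ : ∀ {J S} → Family J S → Subset S
⋃ᶠ 𝒜 = ⋃ (𝒜 ⟨$⟩_)

PairwiseDisjoint : ∀ {J S} → Family J S → Set
PairwiseDisjoint {J} 𝒜 =
  ∀ ξ η → ¬ (ξ ≈ η) → ∀ x → ¬ (x ∈ (𝒜 ⟨$⟩ ξ) ∩ (𝒜 ⟨$⟩ η))
  where open Setoid J using (_≈_)

------------------------------------------------------------------------
-- Abelian Polish groups, with a chosen complete compatible metric.  The
-- topology is by definition the one induced by the metric, and all
-- topological notions are stated through it.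

record AbelianPolishGroup : Set₁ where
  field
    abelianGroup : AbelianGroup 0ℓ 0ℓ

  open AbelianGroup abelianGroup public
    using (Carrier; _≈_; setoid)
    renaming (_∙_ to infixl 6 _+_; ε to 0#; _⁻¹ to -_)

  field
    d        : Carrier → Carrier → ℝ
    isMetric : Metric.IsGeneralMetric _≈_ _≈ᴿ_ _≤ᴿ_ 0ᴿ _+ᴿ_ d
    complete : ∀ (u : ℕ → Carrier) →
      (∀ ε → 0ᴿ <ᴿ ε → ∃[ N ] ∀ m n → N ≤ⁿ m → N ≤ⁿ n → d (u m) (u n) <ᴿ ε) →
      ∃[ x ] ∀ ε → 0ᴿ <ᴿ ε → ∃[ N ] ∀ n → N ≤ⁿ n → d (u n) x <ᴿ ε
    separable : Σ (ℕ → Carrier) λ q →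
      ∀ x ε → 0ᴿ <ᴿ ε → ∃[ n ] d x (q n) <ᴿ ε
    +-continuous : ∀ x y ε → 0ᴿ <ᴿ ε → ∃[ δ ] 0ᴿ <ᴿ δ ×
      (∀ x′ y′ → d x x′ <ᴿ δ → d y y′ <ᴿ δ → d (x + y) (x′ + y′) <ᴿ ε)
    neg-continuous : ∀ x ε → 0ᴿ <ᴿ ε → ∃[ δ ] 0ᴿ <ᴿ δ ×
      (∀ x′ → d x x′ <ᴿ δ → d (- x) (- x′) <ᴿ ε)

module _ (X : AbelianPolishGroup) where
  open AbelianPolishGroup X

  sphere : Carrier → ℝ → Subset setoid
  pred (sphere x r) y = d x y ≈ᴿ r
  resp (sphere x r) {y} {z} y≈z dxy≈r =
    R.trans {d x z} {d x y} {r}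
      (R.sym {d x y} {d x z} (M.cong (Setoid.refl setoid) y≈z)) dxy≈r
    where
      module R = Setoid ℝ-setoid
      module M = Metric.IsGeneralMetric isMetric

  Open : Subset setoid → Set
  Open U = ∀ {x} → x ∈ U → ∃[ ε ] 0ᴿ <ᴿ ε × (∀ y → d x y <ᴿ ε → y ∈ U)

  data Borel : Subset setoid → Set₁ where
    open-set   : ∀ {U} → Open U → Borel U
    complement : ∀ {A} → Borel A → Borel (∁ A)
    union      : ∀ {A : ℕ → Subset setoid} → (∀ n → Borel (A n)) → Borel (⋃ A)
    -- equality of subsets is mutual inclusion
    respects   : ∀ {A B} → A ⊆ B → B ⊆ A → Borel A → Borel B

  translate : Subset setoid → Carrier → Subset setoid
  pred (translate A t) y = ∃[ x ] x ∈ A × y ≈ x + t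
  resp (translate A t) y≈z (x , x∈A , y≈x+t) =
    x , x∈A , Setoid.trans setoid (Setoid.sym setoid y≈z) y≈x+t

  record IsSigmaIdeal (𝓘 : Pred (Subset setoid) i) : Set (lsuc 0ℓ ⊔ˡ i) where
    field
      empty    : 𝓘 (∅ setoid)
      downward : ∀ {A B} → A ⊆ B → 𝓘 B → 𝓘 A
      unions   : ∀ (A : ℕ → Subset setoid) → (∀ n → 𝓘 (A n)) → 𝓘 (⋃ A)

  Proper : Pred (Subset setoid) i → Set i
  Proper 𝓘 = ¬ 𝓘 (full setoid)

  TranslationInvariant : Pred (Subset setoid) i → Set (lsuc 0ℓ ⊔ˡ i)
  TranslationInvariant 𝓘 = ∀ A t → 𝓘 A → 𝓘 (translate A t)

  ContainsSingletons : Pred (Subset setoid) i → Set i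
  ContainsSingletons 𝓘 = ∀ x → 𝓘 ｛ x ｝

  HasBorelBase : Pred (Subset setoid) i → Set (lsuc 0ℓ ⊔ˡ i)
  HasBorelBase 𝓘 = ∀ A → 𝓘 A → ∃[ B ] Borel B × 𝓘 B × A ⊆ B

  CompletelyNonmeasurable : Pred (Subset setoid) i → Subset setoid → Set (lsuc 0ℓ ⊔ˡ i)
  CompletelyNonmeasurable 𝓘 N =
    ∀ A → Borel A → ¬ 𝓘 A → ¬ 𝓘 (A ∩ N) × ¬ 𝓘 (A ∖ N)

  Is2Covering : Subset setoid → Set₁
  Is2Covering A =
    ∀ (C : Subset setoid) → ⟦ C ⟧ ≃ ≡-setoid (Fin 2) → ∃[ x ] translate C x ⊆ A

  -- The <κ-S-covering property of a family, where κ is the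
  -- cardinality of the setoid K.
  IsSCovering : Setoid 0ℓ 0ℓ → ∀ {J} → Family J setoid → Set₁
  IsSCovering K {J} 𝒜 =
    PairwiseDisjoint 𝒜 ×
    (∀ (F : Subset setoid) → ⟦ F ⟧ ≺ K → ∃[ t ]
      translate F t ⊆ ⋃ᶠ 𝒜 ×
      (∀ j → ⟦ translate F t ∩ (𝒜 ⟨$⟩ j) ⟧ ≲ ≡-setoid (Fin 1)))

-- Well-order the canonical representatives of X in type 𝔠.  At stage α a single
-- translation τ α is chosen, and for every ξ < α, and for one further label,
-- the point e ξ + τ α is put into B_ξ, where e enumerates X.  Fewer than 𝔠
-- conditions on τ α ensure that points of different stages never coincide and
-- never differ by ± c, for a fixed c ≠ 0; hence the B_ξ are disjoint and contain
-- no translate of {0, c}.  The further label ξ at stage α serves a request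
-- (ξ , A) that B_ξ meet the Borel set A ∉ 𝓘: there are only 𝔠 of these, and the
-- members of A are 𝔠 many.  Since 2^<𝔠 = 𝔠 makes 𝔠 regular, a set F of fewer
-- than 𝔠 points lies in {e ξ : ξ < α} for some α, and τ α then serves F.
module Submission where

open import Defs
open import Axiom.ExcludedMiddle using (ExcludedMiddle)
open import Axiom.Extensionality.Propositional using (Extensionality)
open import Axiom.UniquenessOfIdentityProofs.WithK using (uip)
open import Data.Product.Base using (Σ; ∃; ∃-syntax; _×_; _,_; proj₁; proj₂; map₂)
open import Function.Bundles using (_⟨$⟩_; _↣_; mk↣; mk⇔; Injection; Func; Bijection; Equivalence)
open import Level using (Level; 0ℓ)
open import Relation.Binary.Bundles using (Setoid)
open import Relation.Nullary.Negation using (¬_; contradiction)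
open import Relation.Unary using (Pred)

open import Algebra.Bundles using (AbelianGroup)
import Algebra.Properties.AbelianGroup as GroupProperties
open import Data.Bool.Base using (Bool; true; false; T; _∨_; if_then_else_)
open import Data.Bool.Properties using (T-≡; T-∨; T-irrelevant; ⇔→≡)
open import Data.Empty using (⊥; ⊥-elim; ⊥-elim-irr)
open import Data.Fin.Base using (Fin; zero; suc; toℕ)
open import Data.Fin.Properties using (toℕ-injective)
open import Data.Integer.Base using (ℤ; +_; -[1+_])
open import Data.List.Base using (List; []; _∷_)
open import Data.List.Membership.Propositional using () renaming (_∈_ to _∈ˡ_; _∉_ to _∉ˡ_)
open import Data.List.Relation.Unary.Any using (here; there)
open import Data.Nat.Base using (ℕ; zero; suc) renaming (_<_ to _<ⁿ_; _⊔_ to _⊔ⁿ_)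
import Data.Nat.Properties as ℕ
open import Data.Product.Function.NonDependent.Propositional using (_×-↣_)
open import Data.Rational.Base as ℚ using (ℚ; mkℚ; 0ℚ; ½)
import Data.Rational.Properties as ℚ
open import Data.Rational.Solver using (module +-*-Solver)
open import Data.Sum.Base using (_⊎_; inj₁; inj₂; [_,_]′)
open import Data.Unit.Base using (⊤; tt)
import Function.Metric.Structures as Metric
open import Function.Base using (_∘_; id; case_of_)
open import Function.Construct.Composition using (_↣-∘_)
open import Induction.WellFounded using (WellFounded; Acc; acc; module All; module FixPoint)
open import Relation.Binary.Definitions using (tri<; tri≈; tri>)
import Relation.Binary.Construct.On as On
open import Relation.Binary.PropositionalEquality
  using (_≡_; _≢_; refl; sym; trans; cong; cong₂; subst) renaming (setoid to ≡-setoid)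
import Relation.Binary.Reasoning.Setoid as ≈-Reasoning
open import Relation.Nullary.Decidable using (yes; no; ⌊_⌋; toWitness; fromWitness; decidable-stable)

-- Bool-valued subsets, well-orders and quotients.

private
  variable
    ℓ : Level
    A C K S : Set

open Injection using () renaming (to to infixl 10 _$↣_; injective to ↣-injective)

-- Bool-valued membership is proof-irrelevant, so elements agree once their first components do.
-- Under function extensionality, subsets with the same members become equal.
Sub : (A → Bool) → Set
Sub P = ∃ λ a → T (P a)

Sub-≡ : ∀ {P : A → Bool} {x y : Sub P} → proj₁ x ≡ proj₁ y → x ≡ y
Sub-≡ {x = _ , p} {y = _ , q} refl = cong (_ ,_) (T-irrelevant p q)

Sub-↣ : (P : A → Bool) → Sub P ↣ A
Sub-↣ P = mk↣ {to = proj₁} Sub-≡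

T-ext : ∀ {b c} → (T b → T c) → (T c → T b) → b ≡ c
T-ext {b} {c} f g = ⇔→≡ {b} {c} (mk⇔
  (Equivalence.to T-≡ ∘ f ∘ Equivalence.from T-≡)
  (Equivalence.to T-≡ ∘ g ∘ Equivalence.from T-≡))

record WellOrder (A : Set) : Set where
  field
    _<ᵇ_    : A → A → Bool

  infix 4 _<_
  _<_ : A → A → Set
  x < y = T (x <ᵇ y)

  field
    wf      : WellFounded _<_
    compare : ∀ x y → x < y ⊎ x ≡ y ⊎ y < x

segment : WellOrder A → A → A → Bool
segment o a x = WellOrder._<ᵇ_ o x a

-- On `Class` propositional equality replaces `_≈_`, so that cardinal arguments can be carried out
-- on plain types.
record Quotient (X : Setoid 0ℓ 0ℓ) : Set₁ where
  open Setoid X using (Carrier; _≈_)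
  field
    Class      : Set
    [_]        : Carrier → Class
    repr       : Class → Carrier
    []-cong    : ∀ {x y} → x ≈ y → [ x ] ≡ [ y ]
    repr-[]    : ∀ x → repr [ x ] ≈ x
    []-repr    : ∀ w → [ repr w ] ≡ w

  []-injective : ∀ {x y} → [ x ] ≡ [ y ] → x ≈ y
  []-injective {x} {y} eq =
    Setoid.trans X (Setoid.sym X (repr-[] x)) (subst (λ w → repr w ≈ y) (sym eq) (repr-[] y))

  repr-injective : ∀ {v w} → repr v ≈ repr w → v ≡ w
  repr-injective {v} {w} eq = trans (sym ([]-repr v)) (trans ([]-cong eq) ([]-repr w))

-- Smallness relative to W: having cardinality less than that of W, in the
-- form "not mapped onto W".
Small : Set → Set → Set
Small W S = ∀ (f : S → W) → ∃ λ w → ∀ s → f s ≢ w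

-- Countable sets

double : ℕ → ℕ
double zero    = zero
double (suc n) = suc (suc (double n))

double-injective : ∀ {m n} → double m ≡ double n → m ≡ n
double-injective {zero}  {zero}  _  = refl
double-injective {suc m} {suc n} eq = cong suc (double-injective (ℕ.suc-injective (ℕ.suc-injective eq)))

odd≢even : ∀ m n → suc (double m) ≢ double n
odd≢even m (suc n) eq = odd≢even n m (sym (ℕ.suc-injective eq))

-- 2^m (2n + 1)
pairing : ℕ → ℕ → ℕ
pairing zero    n = suc (double n)
pairing (suc m) n = double (pairing m n)

pairing-injective : ∀ m m′ {n n′} → pairing m n ≡ pairing m′ n′ → (m , n) ≡ (m′ , n′)
pairing-injective zero    zero     eq = cong (zero ,_) (double-injective (ℕ.suc-injective eq))
pairing-injective zero    (suc m′) eq = ⊥-elim (odd≢even _ _ eq)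
pairing-injective (suc m) zero     eq = ⊥-elim (odd≢even _ _ (sym eq))
pairing-injective (suc m) (suc m′) eq with refl ← pairing-injective m m′ (double-injective eq) = refl

×-↣ℕ : A ↣ ℕ → C ↣ ℕ → (A × C) ↣ ℕ
×-↣ℕ i j = mk↣ {to = λ (m , n) → pairing m n} (λ {(m , _)} {(m′ , _)} → pairing-injective m m′) ↣-∘ (i ×-↣ j)

Bool↣ℕ : Bool ↣ ℕ
Bool↣ℕ = mk↣ {to = code} injective
  where
    code : Bool → ℕ
    code false = 0
    code true  = 1

    injective : ∀ {b c} → code b ≡ code c → b ≡ c
    injective {false} {false} _ = refl
    injective {true}  {true}  _ = refl

⊤↣ℕ : ⊤ ↣ ℕ
⊤↣ℕ = mk↣ {to = λ _ → 0} λ _ → refl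

Fin↣ℕ : ∀ n → Fin n ↣ ℕ
Fin↣ℕ n = mk↣ {to = toℕ} toℕ-injective

ℤ↣ℕ : ℤ ↣ ℕ
ℤ↣ℕ = mk↣ {to = code} injective
  where
    code : ℤ → ℕ
    code (+ n)    = double n
    code -[1+ n ] = suc (double n)

    injective : ∀ {i j} → code i ≡ code j → i ≡ j
    injective {+ m}      {+ n}      eq = cong +_ (double-injective eq)
    injective {+ m}      { -[1+ n ]} eq = ⊥-elim (odd≢even _ _ (sym eq))
    injective { -[1+ m ]} {+ n}      eq = ⊥-elim (odd≢even _ _ eq)
    injective { -[1+ m ]} { -[1+ n ]} eq = cong -[1+_] (double-injective (ℕ.suc-injective eq))

ℚ↣ℕ : ℚ ↣ ℕ
ℚ↣ℕ = ×-↣ℕ ℤ↣ℕ (mk↣ id) ↣-∘ mk↣ {to = λ q → ℚ.numerator q , ℚ.denominator-1 q} injective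
  where
    injective : ∀ {p q} → (ℚ.numerator p , ℚ.denominator-1 p) ≡ (ℚ.numerator q , ℚ.denominator-1 q) → p ≡ q
    injective {mkℚ _ _ _} {mkℚ _ _ _} refl = refl

-- Real numbers

half-sum : ∀ ε → ε ℚ.* ½ ℚ.+ ε ℚ.* ½ ≡ ε
half-sum ε = trans (sym (ℚ.*-distribˡ-+ ε ½ ½)) (ℚ.*-identityʳ ε)

half-pos : ∀ {ε} → 0ℚ ℚ.< ε → 0ℚ ℚ.< ε ℚ.* ½
half-pos {ε} 0<ε = subst (ℚ._< ε ℚ.* ½) (ℚ.*-zeroˡ ½) (ℚ.*-monoˡ-<-pos ½ 0<ε)

constᴿ : ℚ → ℝ
constᴿ q = mkℝ (λ _ → q) λ ε 0<ε → 0 , λ _ _ _ _ → subst (λ z → ℚ.∣ z ∣ ℚ.< ε) (sym (ℚ.+-inverseʳ q)) 0<ε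

constᴿ-positive : ∀ {q} → 0ℚ ℚ.< q → 0ᴿ <ᴿ constᴿ q
constᴿ-positive {q} 0<q = q , 0<q , 0 , λ _ _ → ℚ.≤-reflexive (ℚ.+-identityˡ q)

positive-constᴿ : ∀ ε → 0ᴿ <ᴿ ε → ∃[ q ] 0ℚ ℚ.< q × constᴿ q ≤ᴿ ε
positive-constᴿ ε (q , 0<q , N , q≤ε) = q , 0<q , λ η 0<η → N , λ n N≤n → begin
  q                ≡⟨ ℚ.+-identityˡ q ⟨
  0ℚ ℚ.+ q         ≤⟨ q≤ε n N≤n ⟩
  seq ε n          ≡⟨ ℚ.+-identityʳ _ ⟨
  seq ε n ℚ.+ 0ℚ   ≤⟨ ℚ.+-monoʳ-≤ (seq ε n) (ℚ.<⇒≤ 0<η) ⟩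
  seq ε n ℚ.+ η    ∎
  where open ℚ.≤-Reasoning

≤-<-transᴿ : ∀ {x y z} → x ≤ᴿ y → y <ᴿ z → x <ᴿ z
≤-<-transᴿ {x} {y} {z} x≤y (ε , 0<ε , N , y<z) =
  let (M , x≤y+ε/2) = x≤y (ε ℚ.* ½) (half-pos 0<ε)
  in ε ℚ.* ½ , half-pos 0<ε , M ⊔ⁿ N , λ n M⊔N≤n → begin
    seq x n ℚ.+ ε ℚ.* ½                ≤⟨ ℚ.+-monoˡ-≤ _ (x≤y+ε/2 n (ℕ.m⊔n≤o⇒m≤o M N M⊔N≤n)) ⟩
    seq y n ℚ.+ ε ℚ.* ½ ℚ.+ ε ℚ.* ½    ≡⟨ ℚ.+-assoc (seq y n) _ _ ⟩
    seq y n ℚ.+ (ε ℚ.* ½ ℚ.+ ε ℚ.* ½)  ≡⟨ cong (seq y n ℚ.+_) (half-sum ε) ⟩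
    seq y n ℚ.+ ε                      ≤⟨ y<z n (ℕ.m⊔n≤o⇒n≤o M N M⊔N≤n) ⟩
    seq z n                            ∎
  where open ℚ.≤-Reasoning

<-≤-transᴿ : ∀ {x y z} → x <ᴿ y → y ≤ᴿ z → x <ᴿ z
<-≤-transᴿ {x} {y} {z} (ε , 0<ε , N , x<y) y≤z =
  let (M , y≤z+ε/2) = y≤z (ε ℚ.* ½) (half-pos 0<ε)
  in ε ℚ.* ½ , half-pos 0<ε , M ⊔ⁿ N , λ n M⊔N≤n → cancel (begin
    seq x n ℚ.+ ε ℚ.* ½ ℚ.+ ε ℚ.* ½    ≡⟨ ℚ.+-assoc (seq x n) _ _ ⟩
    seq x n ℚ.+ (ε ℚ.* ½ ℚ.+ ε ℚ.* ½)  ≡⟨ cong (seq x n ℚ.+_) (half-sum ε) ⟩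
    seq x n ℚ.+ ε                      ≤⟨ x<y n (ℕ.m⊔n≤o⇒n≤o M N M⊔N≤n) ⟩
    seq y n                            ≤⟨ y≤z+ε/2 n (ℕ.m⊔n≤o⇒m≤o M N M⊔N≤n) ⟩
    seq z n ℚ.+ ε ℚ.* ½                ∎)
  where
    open ℚ.≤-Reasoning
    cancel : ∀ {p q r} → p ℚ.+ r ℚ.≤ q ℚ.+ r → p ℚ.≤ q
    cancel {p} {q} {r} p+r≤q+r = begin
      p                ≡⟨ undo p ⟨
      p ℚ.+ r ℚ.- r    ≤⟨ ℚ.+-monoˡ-≤ (ℚ.- r) p+r≤q+r ⟩
      q ℚ.+ r ℚ.- r    ≡⟨ undo q ⟩
      q                ∎
      where
        undo : ∀ s → s ℚ.+ r ℚ.- r ≡ s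
        undo s = trans (ℚ.+-assoc s r (ℚ.- r)) (trans (cong (s ℚ.+_) (ℚ.+-inverseʳ r)) (ℚ.+-identityʳ s))

<-+-<ᴿ : ∀ {x y p q} → x <ᴿ constᴿ p → y <ᴿ constᴿ q → x +ᴿ y <ᴿ constᴿ (p ℚ.+ q)
<-+-<ᴿ {x} {y} {p} {q} (ε , 0<ε , M , x<p) (η , 0<η , N , y<q) =
  ε ℚ.+ η , ℚ.+-mono-< 0<ε 0<η , M ⊔ⁿ N , λ n M⊔N≤n → begin
    seq x n ℚ.+ seq y n ℚ.+ (ε ℚ.+ η)    ≡⟨ interchange (seq x n) (seq y n) ε η ⟩
    (seq x n ℚ.+ ε) ℚ.+ (seq y n ℚ.+ η)  ≤⟨ ℚ.+-mono-≤ (x<p n (ℕ.m⊔n≤o⇒m≤o M N M⊔N≤n))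
                                                       (y<q n (ℕ.m⊔n≤o⇒n≤o M N M⊔N≤n)) ⟩
    p ℚ.+ q                              ∎
  where
    open ℚ.≤-Reasoning
    interchange : ∀ a b c d → a ℚ.+ b ℚ.+ (c ℚ.+ d) ≡ (a ℚ.+ c) ℚ.+ (b ℚ.+ d)
    interchange = solve 4 (λ a b c d → a :+ b :+ (c :+ d) := (a :+ c) :+ (b :+ d)) refl
      where open +-*-Solver

-- Codes of Borel sets: a countable union of balls with centre in the dense
-- sequence and rational radius, or the complement of a countable union.

data Code : Set where
  balls : (ℕ × ℚ → Bool) → Code
  nor   : (ℕ → Code) → Code

-- Consequences of excluded middle and extensionality.

module Classical (em : ∀ {ℓ} → ExcludedMiddle ℓ) (ext : ∀ {a b} → Extensionality a b) where

  -- The value is a Bool at every level `ℓ`, so conditions that quantify over large types still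
  -- define small subsets.
  truth : Set ℓ → Bool
  truth P = ⌊ em {P = P} ⌋

  truth⁺ : {P : Set ℓ} → P → T (truth P)
  truth⁺ {P = P} = fromWitness {a? = em {P = P}}

  truth⁻ : {P : Set ℓ} → T (truth P) → P
  truth⁻ {P = P} = toWitness {a? = em {P = P}}

  by-contra : {P : Set ℓ} → ¬ ¬ P → P
  by-contra = decidable-stable em

  ¬∀⇒∃¬ : ∀ {a} {A : Set a} {P : A → Set ℓ} → ¬ (∀ x → P x) → ∃ λ x → ¬ P x
  ¬∀⇒∃¬ ¬∀ = by-contra λ ¬∃ → ¬∀ λ x → by-contra λ ¬Px → ¬∃ (x , ¬Px)

  -- Excluded middle decides which element of Sub χ it exhibits from χ alone.
  pick : (χ : C → Bool) → .(Sub χ) → Sub χ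
  pick χ s with em {P = Sub χ}
  ... | yes found = found
  ... | no none   = ⊥-elim-irr (none s)

  -- Canonical representatives of equivalence classes.

  module _ (X : Setoid 0ℓ 0ℓ) where
    open Setoid X using (Carrier; _≈_) renaming (refl to ≈-refl; sym to ≈-sym; trans to ≈-trans)

    private
      class : Carrier → Carrier → Bool
      class x y = truth (y ≈ x)

      class-cong : ∀ {x y} → x ≈ y → class x ≡ class y
      class-cong x≈y = ext λ z → T-ext
        (λ p → truth⁺ (≈-trans (truth⁻ p) x≈y))
        (λ p → truth⁺ (≈-trans (truth⁻ p) (≈-sym x≈y)))

      canonical : ∀ x → Sub (class x)
      canonical x = pick (class x) (x , truth⁺ ≈-refl)

      rep : Carrier → Carrier
      rep x = proj₁ (canonical x)

      rep-≈ : ∀ x → rep x ≈ x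
      rep-≈ x = truth⁻ (proj₂ (canonical x))

      -- The inhabitant handed to `pick` is irrelevant, so the element chosen depends only on the
      -- class. This makes the representative the same for equivalent points.
      pick-cong : {χ χ′ : Carrier → Bool} (eq : χ ≡ χ′) .(s : Sub χ) .(s′ : Sub χ′) →
                  proj₁ (pick χ s) ≡ proj₁ (pick χ′ s′)
      pick-cong refl s s′ = refl

      rep-cong : ∀ {x y} → x ≈ y → rep x ≡ rep y
      rep-cong x≈y = pick-cong (class-cong x≈y) _ _

    opaque
      quotient : Quotient X
      quotient = record
        -- The fixed points of `rep` contain exactly one point of each class, and `uip` makes the
        -- attached equation unique.
        { Class   = ∃ λ x → rep x ≡ x
        ; [_]     = λ x → rep x , rep-cong (rep-≈ x)
        ; repr    = proj₁
        ; []-cong = λ x≈y → Canonical-≡ (rep-cong x≈y)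
        ; repr-[] = rep-≈
        ; []-repr = λ (_ , eq) → Canonical-≡ eq
        }
        where
          Canonical-≡ : ∀ {v w : ∃ λ x → rep x ≡ x} → proj₁ v ≡ proj₁ w → v ≡ w
          Canonical-≡ {_ , p} {_ , q} refl = cong (_ ,_) (uip p q)

  -- Zermelo's theorem, by linearity of the tower of subsets generated by
  -- unions and by adding a chosen element of the complement.
  module Zermelo (A : Set) where

    private
      _∋_ : (A → Bool) → A → Set
      p ∋ x = T (p x)

      _⊑_ : (A → Bool) → (A → Bool) → Set
      p ⊑ q = ∀ x → p ∋ x → q ∋ x

      ⊑-antisym : ∀ {p q} → p ⊑ q → q ⊑ p → p ≡ q
      ⊑-antisym f g = ext λ x → T-ext (f x) (g x)

      ⋁ : {I : Set} → (I → A → Bool) → A → Bool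
      ⋁ F x = truth (∃ λ i → F i ∋ x)

      next : (A → Bool) → A → Bool
      next p with em {P = ∃ λ a → ¬ (p ∋ a)}
      ... | yes (a , _) = λ x → p x ∨ truth (x ≡ a)
      ... | no _        = p

      ⊑-next : ∀ p → p ⊑ next p
      ⊑-next p with em {P = ∃ λ a → ¬ (p ∋ a)}
      ... | yes _ = λ _ → Equivalence.from T-∨ ∘ inj₁
      ... | no _  = λ _ → id

      next-new : ∀ p x → ¬ (p ∋ x) →
                 ∃ λ a → ¬ (p ∋ a) × (next p ∋ a) × (∀ {y} → next p ∋ y → p ∋ y ⊎ y ≡ a)
      next-new p x ∌x with em {P = ∃ λ a → ¬ (p ∋ a)}
      ... | yes (a , ∌a) = a , ∌a , Equivalence.from (T-∨ {p a}) (inj₂ (truth⁺ refl)) , λ {y} ∋y →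
              [ inj₁ , (λ y≡a → inj₂ (truth⁻ y≡a)) ]′ (Equivalence.to (T-∨ {p y}) ∋y)
      ... | no none = contradiction (x , ∌x) none

      -- The tower starts at the empty subset, which is the `join` of the empty family.
      data Tower : (A → Bool) → Set₁ where
        step : ∀ {p} → Tower p → Tower (next p)
        join : {I : Set} (F : I → A → Bool) → (∀ i → Tower (F i)) → Tower (⋁ F)

      -- Linearity in the form that survives induction: no member of the tower lies strictly between
      -- `q` and `next q`.
      Comparable : (A → Bool) → (A → Bool) → Set
      Comparable p q = p ⊑ q ⊎ next q ⊑ p

      join-comparable : ∀ {I : Set} {F : I → A → Bool} {q} →
                        (∀ i → Comparable (F i) q) → Comparable (⋁ F) q
      join-comparable {F = F} {q} cmp with em {P = ∃ λ i → next q ⊑ F i}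
      ... | yes (i , q⊏Fi) = inj₂ λ x ∋x → truth⁺ (i , q⊏Fi x ∋x)
      ... | no none = inj₁ λ x ∋x → let (i , Fi∋x) = truth⁻ ∋x in
              [ (λ Fi⊑q → Fi⊑q x Fi∋x) , (λ q⊏Fi → ⊥-elim (none (i , q⊏Fi))) ]′ (cmp i)

      -- Induction on the tower containing `q`. In the step, the only case not settled at once is
      -- `q ⊑ p ⊑ q`, where `p` and `q` are equal and so have the same successor.
      flip-comparable : ∀ {p} → (∀ {q} → Tower q → Comparable p q) →
                        ∀ {q} → Tower q → Comparable q p
      flip-comparable cmp (join F F∈) = join-comparable λ i → flip-comparable cmp (F∈ i)
      flip-comparable {p} cmp (step {q} q∈) with flip-comparable cmp q∈ | cmp q∈
      ... | inj₂ p⊏q | _        = inj₂ λ x → ⊑-next q x ∘ p⊏q x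
      ... | inj₁ _   | inj₂ q⊏p = inj₁ q⊏p
      ... | inj₁ q⊑p | inj₁ p⊑q with refl ← ⊑-antisym {p} {q} p⊑q q⊑p = inj₂ λ _ → id

      comparable : ∀ {p q} → Tower p → Tower q → Comparable p q
      comparable (join F F∈) q∈ = join-comparable λ i → comparable (F∈ i) q∈
      comparable {q = q} (step {p} p∈) q∈ with comparable p∈ q∈ | flip-comparable (comparable p∈) q∈
      ... | inj₂ q⊏p | _        = inj₂ λ x → ⊑-next p x ∘ q⊏p x
      ... | inj₁ _   | inj₂ p⊏q = inj₁ p⊏q
      ... | inj₁ p⊑q | inj₁ q⊑p with refl ← ⊑-antisym {p} {q} p⊑q q⊑p = inj₂ λ _ → id

      _≺ᵇ_ : A → A → Bool
      x ≺ᵇ y = truth (∃ λ p → Tower p × (p ∋ x) × ¬ (p ∋ y))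

      asym : ∀ {x y} → T (x ≺ᵇ y) → ¬ T (y ≺ᵇ x)
      asym x<y y<x with truth⁻ x<y | truth⁻ y<x
      ... | p , p∈ , p∋x , p∌y | q , q∈ , q∋y , q∌x with comparable p∈ q∈
      ...   | inj₁ p⊑q = q∌x (p⊑q _ p∋x)
      ...   | inj₂ q⊏p = p∌y (q⊏p _ (⊑-next q _ q∋y))

      -- The union of all tower members disjoint from `χ` is the largest such member. Its successor
      -- must meet `χ`, and does so only in the one new element, which is therefore least.
      least : ∀ χ → Sub χ → ∃ λ m → χ ∋ m × (∀ {y} → χ ∋ y → y ≢ m → T (m ≺ᵇ y))
      least χ (s , χ∋s) = m , χ∋m , λ {y} χ∋y y≢m →
        truth⁺ (next avoiding , step avoiding-tower , ∋m , λ ∋y →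
          [ (λ old → avoids old χ∋y) , y≢m ]′ (only ∋y))
        where
          Avoiding : (A → Bool) → Set₁
          Avoiding p = Tower p × (∀ x → p ∋ x → ¬ (χ ∋ x))

          -- `Avoiding` lives in `Set₁`; `truth` cuts the index type down to `Set`, as `join`
          -- demands.
          members : Sub (λ p → truth (Avoiding p)) → A → Bool
          members = proj₁

          avoiding : A → Bool
          avoiding = ⋁ members

          avoiding-tower : Tower avoiding
          avoiding-tower = join members λ (_ , p∈) → proj₁ (truth⁻ p∈)

          avoids : ∀ {x} → avoiding ∋ x → ¬ (χ ∋ x)
          avoids ∋x = let ((_ , p∈) , p∋x) = truth⁻ ∋x in proj₂ (truth⁻ p∈) _ p∋x

          new  = next-new avoiding s λ ∋s → avoids ∋s χ∋s
          m    = proj₁ new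
          ∌m   = proj₁ (proj₂ new)
          ∋m   = proj₁ (proj₂ (proj₂ new))
          only = λ {y} → proj₂ (proj₂ (proj₂ new)) {y}

          χ∋m : χ ∋ m
          -- Otherwise the successor would itself avoid `χ` and be part of the union, which would
          -- already contain `m`.
          χ∋m = by-contra λ χ∌m → ∌m (truth⁺
            ((next avoiding , truth⁺ (step avoiding-tower , λ x ∋x χ∋x →
                [ (λ old → avoids old χ∋x) , (λ x≡m → χ∌m (subst (χ ∋_) x≡m χ∋x)) ]′ (only ∋x)))
            , ∋m))

    wellOrder : WellOrder A
    wellOrder = record { _<ᵇ_ = _≺ᵇ_ ; wf = wf ; compare = compare }
      where
        wf : WellFounded (λ x y → T (x ≺ᵇ y))
        wf x = by-contra λ ¬acc →
          let (m , ¬acc-m , min) = least (λ y → truth (¬ Acc _ y)) (x , truth⁺ ¬acc)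
          in truth⁻ ¬acc-m (acc λ {y} y<m → by-contra λ ¬acc-y →
               case em {P = y ≡ m} of λ where
                 (yes refl) → asym y<m y<m
                 (no y≢m)   → asym y<m (min (truth⁺ ¬acc-y) y≢m))

        compare : ∀ x y → T (x ≺ᵇ y) ⊎ x ≡ y ⊎ T (y ≺ᵇ x)
        compare x y with least (λ z → truth (z ≡ x ⊎ z ≡ y)) (x , truth⁺ (inj₁ refl)) | em {P = x ≡ y}
        ... | _             | yes x≡y = inj₂ (inj₁ x≡y)
        ... | m , ∋m , min | no x≢y with truth⁻ ∋m
        ...   | inj₁ refl = inj₁ (min (truth⁺ (inj₂ refl)) (x≢y ∘ sym))
        ...   | inj₂ refl = inj₂ (inj₂ (min (truth⁺ (inj₁ refl)) x≢y))

  -- With `id` for `f` this is a left inverse of the injection, hence a surjection of `C` onto `S`;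
  -- `b` is the value off the range.
  extend : {B : Set ℓ} → S ↣ C → B → (S → B) → C → B
  extend i b f c with em {P = ∃ λ s → i $↣ s ≡ c}
  ... | yes (s , _) = f s
  ... | no _        = b

  extend-to : {B : Set ℓ} (i : S ↣ C) (b : B) (f : S → B) (s : S) → extend i b f (i $↣ s) ≡ f s
  extend-to i b f s with em {P = ∃ λ s′ → i $↣ s′ ≡ i $↣ s}
  ... | yes (_ , eq) = cong f (↣-injective i eq)
  ... | no none      = contradiction (s , refl) none

  insert : A → (A → Bool) → A → Bool
  insert a P x = P x ∨ truth (x ≡ a)

  -- Cardinal arithmetic of 𝔠.

  record Arithmetic (W : Set) : Set₁ where
    field
      ℕ↣W             : ℕ ↣ W
      families        : (ℕ × ℚ → Bool) ↣ W
      sequences       : (ℕ → W) ↣ W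
      pairs           : (W × W) ↣ W
      small-countable : S ↣ ℕ → Small W S
      small-Σ         : {Y : K → Set} → K ↣ W → Small W K → (∀ k → Small W (Y k)) → Small W (Σ K Y)
      small-insert    : ∀ {P : W → Bool} w → Small W (Sub P) → Small W (Sub (insert w P))
      order           : WellOrder W
      segment-small   : ∀ w → Small W (Sub (segment order w))

  -- `digits` bounds `W` by ℵ₀^ℵ₀ = 2^ℵ₀, and `pow` for countable `K` gives the converse bound.
  module Continuum
    (W : Set) (w₀ : W)
    (ℕ-small : Small W ℕ)
    (pow : ∀ {K : Set} → K ↣ W → Small W K → (K → Bool) ↣ W)
    (digits : W ↣ (ℕ → ℚ))
    where

    small-surj : (g : S → C) → (∀ c → ∃ λ s → g s ≡ c) → Small W S → Small W C
    small-surj g onto small f = map₂ avoid (small (f ∘ g))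
      where
        avoid : ∀ {w} → (∀ s → f (g s) ≢ w) → ∀ c → f c ≢ w
        avoid ≢w c with s , refl ← onto c = ≢w s

    small-↣ : S ↣ C → Small W C → Small W S
    small-↣ i small f = map₂ (λ ≢w s eq → ≢w (i $↣ s) (trans (extend-to i w₀ f s) eq)) (small (extend i w₀ f))

    -- No list exhausts `W`, because its entries are values of a map from ℕ. Each new element is
    -- taken outside the list of the earlier ones.
    ℕ↣W : ℕ ↣ W
    ℕ↣W = mk↣ {to = element} injective
      where
        nth : List W → ℕ → W
        nth []      _       = w₀
        nth (x ∷ l) zero    = x
        nth (x ∷ l) (suc n) = nth l n

        ∈⇒nth : ∀ {w l} → w ∈ˡ l → ∃ λ n → nth l n ≡ w
        ∈⇒nth (here w≡x)  = zero , sym w≡x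
        ∈⇒nth (there w∈l) = let (n , eq) = ∈⇒nth w∈l in suc n , eq

        fresh : ∀ l → ∃ λ w → w ∉ˡ l
        fresh l = map₂ (λ ≢w w∈l → let (n , eq) = ∈⇒nth w∈l in ≢w n eq) (ℕ-small (nth l))

        initial : ℕ → List W
        initial zero    = []
        initial (suc n) = proj₁ (fresh (initial n)) ∷ initial n

        element : ℕ → W
        element n = proj₁ (fresh (initial n))

        ∈-initial : ∀ {m} n → m <ⁿ n → element m ∈ˡ initial n
        ∈-initial (suc n) m<1+n with ℕ.m≤n⇒m<n∨m≡n (ℕ.≤-pred m<1+n)
        ... | inj₁ m<n  = there (∈-initial n m<n)
        ... | inj₂ refl = here refl

        distinct : ∀ {m n} → m <ⁿ n → element m ≢ element n
        distinct {n = n} m<n eq = proj₂ (fresh (initial n)) (subst (_∈ˡ initial n) eq (∈-initial n m<n))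

        injective : ∀ {m n} → element m ≡ element n → m ≡ n
        injective {m} {n} eq with ℕ.<-cmp m n
        ... | tri< m<n _ _ = contradiction eq (distinct m<n)
        ... | tri≈ _ m≡n _ = m≡n
        ... | tri> _ _ n<m = contradiction (sym eq) (distinct n<m)

    small-countable : S ↣ ℕ → Small W S
    small-countable i = small-↣ i ℕ-small

    ℕ×ℚ↣ℕ : (ℕ × ℚ) ↣ ℕ
    ℕ×ℚ↣ℕ = ×-↣ℕ (mk↣ id) ℚ↣ℕ

    -- An element is coded by the graph of its rational sequence, a subset of a countable set.
    bits : W ↣ (ℕ × ℚ → Bool)
    bits = mk↣ {to = to} λ {v} {w} eq → ↣-injective digits (ext λ n →
      truth⁻ (subst (λ f → T (f (n , (digits $↣ v) n))) eq (truth⁺ refl)))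
      where
        to : W → ℕ × ℚ → Bool
        to w (n , q) = truth (q ≡ (digits $↣ w) n)

    -- W^K ≤ (2^ℵ₀)^K
    functions′ : (K × (ℕ × ℚ)) ↣ W → Small W (K × (ℕ × ℚ)) → (K → W) ↣ W
    functions′ {K} i small = pow i small ↣-∘ mk↣ {to = to} λ {f} {g} eq → ext λ k →
      ↣-injective bits (ext λ c → cong (λ h → h (k , c)) eq)
      where
        to : (K → W) → K × (ℕ × ℚ) → Bool
        to f (k , c) = (bits $↣ f k) c

    sequences : (ℕ → W) ↣ W
    sequences = functions′ (ℕ↣W ↣-∘ ℕ×Q↣ℕ) (small-countable ℕ×Q↣ℕ)
      where
        ℕ×Q↣ℕ : (ℕ × (ℕ × ℚ)) ↣ ℕ
        ℕ×Q↣ℕ = ×-↣ℕ (mk↣ id) ℕ×ℚ↣ℕ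

    pairs : (W × W) ↣ W
    pairs = sequences ↣-∘ mk↣ {to = to} λ eq → cong₂ _,_ (cong (λ f → f 0) eq) (cong (λ f → f 1) eq)
      where
        to : W × W → ℕ → W
        to (v , w) zero    = v
        to (v , w) (suc _) = w

    -- König's diagonal argument.
    small-Σ′ : {Y : K → Set} → (K → W) ↣ W → (∀ k → Small W (Y k)) → Small W (Σ K Y)
    small-Σ′ {K} {Y} code small f = code $↣ (proj₁ ∘ missed) , λ (k , y) eq →
      proj₂ (missed k) y (cong (λ h → h k) (trans (cong decode eq) (extend-to code _ id _)))
      where
        decode : W → K → W
        decode = extend code (λ _ → w₀) id

        missed : ∀ k → ∃ λ w → ∀ y → decode (f (k , y)) k ≢ w
        missed k = small k λ y → decode (f (k , y)) k

    -- The product of `K` with a countable set has to be small first. König's argument is applied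
    -- with ℕ as the index type, where `sequences` already supplies the coding; this is why the
    -- factors are swapped.
    functions : K ↣ W → Small W K → (K → W) ↣ W
    functions {K} i small = functions′
      (pairs ↣-∘ (i ×-↣ (ℕ↣W ↣-∘ ℕ×ℚ↣ℕ)))
      (small-↣ swapped (small-Σ′ sequences λ _ → small))
      where
        swapped : (K × (ℕ × ℚ)) ↣ (ℕ × K)
        swapped = mk↣ {to = λ (k , c) → ℕ×ℚ↣ℕ $↣ c , k} λ eq →
          cong₂ _,_ (cong proj₂ eq) (↣-injective ℕ×ℚ↣ℕ (cong proj₁ eq))

    small-Σ : {Y : K → Set} → K ↣ W → Small W K → (∀ k → Small W (Y k)) → Small W (Σ K Y)
    small-Σ i small = small-Σ′ (functions i small)

    small-⊎ : Small W S → Small W C → Small W (S ⊎ C)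
    small-⊎ {S} {C} small-S small-C =
      small-surj {S = Σ Bool Y} join onto
        (small-Σ (ℕ↣W ↣-∘ Bool↣ℕ) (small-countable Bool↣ℕ) λ where
          true → small-S
          false → small-C)
      where
        Y : Bool → Set
        Y b = if b then S else C

        join : Σ Bool Y → S ⊎ C
        join (true , s)  = inj₁ s
        join (false , c) = inj₂ c

        onto : ∀ z → ∃ λ p → join p ≡ z
        onto (inj₁ s) = (true , s) , refl
        onto (inj₂ c) = (false , c) , refl

    small-insert : ∀ {P : W → Bool} v → Small W (Sub P) → Small W (Sub (insert v P))
    small-insert {P} v small =
      small-surj to onto (small-⊎ small (small-countable ⊤↣ℕ))
      where
        to : Sub P ⊎ ⊤ → Sub (insert v P)
        to (inj₁ (w , p)) = w , Equivalence.from T-∨ (inj₁ p)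
        to (inj₂ tt)      = v , Equivalence.from (T-∨ {P v}) (inj₂ (truth⁺ refl))

        onto : ∀ y → ∃ λ z → to z ≡ y
        onto (w , p) with Equivalence.to (T-∨ {P w}) p
        ... | inj₁ old = inj₁ (w , old) , Sub-≡ refl
        ... | inj₂ new with refl ← truth⁻ new = inj₂ tt , Sub-≡ refl

    -- A well-order is pulled back along a bijection of W with the shortest
    -- initial segment that is not small.
    initialOrder : Σ (WellOrder W) λ o → ∀ w → Small W (Sub (segment o w))
    initialOrder with em {P = ∃ λ w → ¬ Small W (Sub (segment wellOrder w))}
      where open Zermelo W
    ... | no none = wellOrder , λ w → by-contra λ ¬small → none (w , ¬small)
      where open Zermelo W
    ... | yes (w₁ , ¬small₁) = pulled , small
      where
        open WellOrder (Zermelo.wellOrder W) using (_<_; wf; compare)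

        Seg : W → Set
        Seg w = Sub (segment (Zermelo.wellOrder W) w)

        shortest : ∀ w → Acc _<_ w → ¬ Small W (Seg w) →
                   ∃ λ m → ¬ Small W (Seg m) × (∀ {v} → v < m → Small W (Seg v))
        shortest w (acc below) ¬small with em {P = ∃ λ v → v < w × ¬ Small W (Seg v)}
        ... | yes (v , v<w , ¬small-v) = shortest v (below v<w) ¬small-v
        ... | no none = w , ¬small , λ v<w → by-contra λ ¬small-v → none (_ , v<w , ¬small-v)

        m       = proj₁ (shortest w₁ (wf w₁) ¬small₁)
        minimal = λ {v} → proj₂ (proj₂ (shortest w₁ (wf w₁) ¬small₁)) {v}

        onto : ∃ λ (g : Seg m → W) → ∀ w → ∃ λ s → g s ≡ w
        onto =
          -- Failure of smallness is a map from the segment that misses no element of `W`.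
          let (g , ¬missed) = ¬∀⇒∃¬ (proj₁ (proj₂ (shortest w₁ (wf w₁) ¬small₁)))
          in g , λ w → by-contra λ ¬hit → ¬missed (w , λ s eq → ¬hit (s , eq))

        section : W → Seg m
        section w = proj₁ (proj₂ onto w)

        j : W → W
        j = proj₁ ∘ section

        j-injective : ∀ {v w} → j v ≡ j w → v ≡ w
        j-injective {v} {w} eq = trans (sym (proj₂ (proj₂ onto v)))
          (trans (cong (proj₁ onto) (Sub-≡ {x = section v} {section w} eq)) (proj₂ (proj₂ onto w)))

        pulled : WellOrder W
        pulled = record
          { _<ᵇ_    = λ v w → segment (Zermelo.wellOrder W) (j w) (j v)
          ; wf      = On.wellFounded j wf
          ; compare = λ v w → case compare (j v) (j w) of λ where
              (inj₁ v<w)        → inj₁ v<w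
              (inj₂ (inj₁ v≡w)) → inj₂ (inj₁ (j-injective v≡w))
              (inj₂ (inj₂ w<v)) → inj₂ (inj₂ w<v)
          }

        small : ∀ w → Small W (Sub (segment pulled w))
        small w = small-↣
          (mk↣ {to = λ (v , v<w) → j v , v<w} λ eq → Sub-≡ (j-injective (cong proj₁ eq)))
          (minimal (proj₂ (section w)))

    arithmetic : Arithmetic W
    arithmetic = record
      { ℕ↣W             = ℕ↣W
      ; families        = pow (ℕ↣W ↣-∘ ℕ×ℚ↣ℕ) (small-countable ℕ×ℚ↣ℕ)
      ; sequences       = sequences
      ; pairs           = pairs
      ; small-countable = small-countable
      ; small-Σ         = small-Σ
      ; small-insert    = small-insert
      ; order           = proj₁ initialOrder
      ; segment-small   = proj₂ initialOrder
      }

  -- Borel sets and their codes.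

  module BorelCodes (X : AbelianPolishGroup) where
    open AbelianPolishGroup X
    private
      module M = Metric.IsGeneralMetric isMetric

    infix 4 _≐_
    _≐_ : Subset setoid → Subset setoid → Set
    A ≐ B = A ⊆ B × B ⊆ A

    centre : ℕ → Carrier
    centre = proj₁ separable

    ball : ℕ → ℚ → Subset setoid
    pred (ball n r) x = d x (centre n) <ᴿ constᴿ r
    resp (ball n r) {x} {y} x≈y =
      ≤-<-transᴿ {d y (centre n)} {d x (centre n)} {constᴿ r}
        (proj₂ (M.cong x≈y (Setoid.refl setoid)))

    ⟪_⟫ : Code → Subset setoid
    ⟪ balls s ⟫ = ⋃ {J = Sub s} λ ((n , r) , _) → ball n r
    ⟪ nor cs ⟫  = ∁ (⋃ λ n → ⟪ cs n ⟫)

    small-ball : ∀ {U x} → Open X U → x ∈ U → ∃[ n ] ∃[ r ] x ∈ ball n r × ball n r ⊆ U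
    small-ball {U} {x} open-U x∈U =
      let (ε , 0<ε , near)  = open-U x∈U
          (q , 0<q , q≤ε)   = positive-constᴿ ε 0<ε
          -- Two points within `r` of the same centre are closer than `q`, which is at most `ε`.
          r                 = q ℚ.* ½
          (n , x∈ball)      = proj₂ separable x (constᴿ r) (constᴿ-positive (half-pos 0<q))
      in n , r , x∈ball , λ {y} y∈ball → near y
           (<-≤-transᴿ {d x y} {constᴿ q} {ε}
             (≤-<-transᴿ {d x y} {d x (centre n) +ᴿ d (centre n) y} {constᴿ q} (M.triangle x (centre n) y)
               (subst (λ p → d x (centre n) +ᴿ d (centre n) y <ᴿ constᴿ p) (half-sum q)
                 (<-+-<ᴿ {d x (centre n)} {d (centre n) y} {r} {r} x∈ball
                   (≤-<-transᴿ {d (centre n) y} {d y (centre n)} {constᴿ r}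
                     (proj₁ (M.sym (centre n) y)) y∈ball))))
             q≤ε)

    -- An open set is the union of the coded balls that it contains. `nor` of a constant sequence is
    -- a complement, and a complement of a `nor` is a union.
    borel-code : ∀ {A} → Borel X A → ∃[ c ] A ≐ ⟪ c ⟫
    borel-code (open-set {U} open-U) =
      balls (λ (n , r) → truth (ball n r ⊆ U)) ,
      (λ x∈U → let (n , r , x∈ball , ball⊆U) = small-ball {U} open-U x∈U
               in ((n , r) , truth⁺ (λ {y} → ball⊆U {y})) , x∈ball) ,
      λ ((_ , ball⊆U) , x∈ball) → truth⁻ ball⊆U x∈ball
    borel-code (complement borel-A) =
      let (c , A⊆c , c⊆A) = borel-code borel-A
      in nor (λ _ → c) , (λ x∉A (_ , x∈c) → x∉A (c⊆A x∈c)) , λ x∉c x∈A → x∉c (0 , A⊆c x∈A)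
    borel-code (union {A} borel-A) =
      nor (λ _ → nor (λ n → proj₁ (code n))) ,
      (λ (n , x∈An) (_ , x∉⋃) → x∉⋃ (n , proj₁ (proj₂ (code n)) x∈An)) ,
      λ x∉∁⋃ → map₂ (λ {n} → proj₂ (proj₂ (code n))) (by-contra λ x∉⋃ → x∉∁⋃ (0 , x∉⋃))
      where
        code : ∀ n → ∃[ c ] A n ≐ ⟪ c ⟫
        code n = borel-code (borel-A n)
    borel-code (respects A⊆B B⊆A borel-A) =
      let (c , A⊆c , c⊆A) = borel-code borel-A
      in c , (λ x∈B → A⊆c (B⊆A x∈B)) , λ x∈c → A⊆B (c⊆A x∈c)

    borel-full : Borel X (full setoid)
    borel-full = open-set λ _ → constᴿ ½ , constᴿ-positive (ℚ.positive⁻¹ ½) , λ _ _ → tt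

    borel-∖ : ∀ {A B} → Borel X A → Borel X B → Borel X (A ∖ B)
    borel-∖ {A} {B} borel-A borel-B = respects
      (λ x∉ → by-contra (λ x∉A → x∉ (0 , x∉A)) , λ x∈B → x∉ (1 , x∈B))
      (λ (x∈A , x∉B) → λ where
        (zero  , x∉A) → x∉A x∈A
        (suc _ , x∈B) → x∉B x∈B)
      (complement (union borel-parts))
      where
        parts : ℕ → Subset setoid
        parts zero    = ∁ A
        parts (suc _) = B

        borel-parts : ∀ n → Borel X (parts n)
        borel-parts zero    = complement borel-A
        borel-parts (suc _) = borel-B

  -- The construction in the group; first, `X` has cardinality 𝔠.

  module Construction
    {i : Level} (X : AbelianPolishGroup)
    (uncountable : ¬ Countable (AbelianPolishGroup.setoid X))
    (𝓘 : Pred (Subset (AbelianPolishGroup.setoid X)) i)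
    (σ-ideal : IsSigmaIdeal X 𝓘)
    (proper : Proper X 𝓘)
    (borel-base : HasBorelBase X 𝓘)
    (large : ∀ B → Borel X B → ¬ 𝓘 B →
      ∀ (K : Setoid 0ℓ 0ℓ) → K ≺ ℝ-setoid →
      ∀ (𝓓 : Family K (AbelianPolishGroup.setoid X)) → (∀ k → 𝓘 (𝓓 ⟨$⟩ k)) →
      ⟦ B ∖ ⋃ᶠ 𝓓 ⟧ ≃ ℝ-setoid)
    (2^<𝔠≤𝔠 : ∀ (K : Setoid 0ℓ 0ℓ) → K ≺ ℝ-setoid → 2^ K ≲ ℝ-setoid)
    where
    open AbelianPolishGroup X
    open BorelCodes X
    open IsSigmaIdeal σ-ideal
    open Setoid setoid using () renaming (refl to ≈-refl; sym to ≈-sym; trans to ≈-trans)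
    private module R = Setoid ℝ-setoid

    open Quotient (quotient setoid) renaming (Class to W; repr to e)

    module _ {A} (borel-A : Borel X A) (A∉𝓘 : ¬ 𝓘 A) where
      private
        none : Family (≡-setoid ⊥) setoid
        none = record { to = λ () ; cong = λ { {()} } }

        ⊥≺ℝ : ≡-setoid ⊥ ≺ ℝ-setoid
        ⊥≺ℝ = record { to = λ () ; cong = λ { {()} } ; injective = λ { {()} } } ,
              λ j → Injection.to j 0ᴿ

      -- Largeness applied to the empty family gives `A` itself 𝔠 members.
      members≃ℝ : ⟦ A ∖ ⋃ᶠ none ⟧ ≃ ℝ-setoid
      members≃ℝ = large A borel-A A∉𝓘 (≡-setoid ⊥) ⊥≺ℝ none λ ()

      member : ℝ → Carrier
      member r = proj₁ (Bijection.to⁻ members≃ℝ r)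

      member-∈ : ∀ r → member r ∈ A
      member-∈ r = proj₁ (proj₂ (Bijection.to⁻ members≃ℝ r))

      member-injective : ∀ {r s} → member r ≈ member s → r R.≈ s
      member-injective {r} {s} eq = R.trans {r} {to (to⁻ r)} {s} (R.sym {to (to⁻ r)} {r} (to∘to⁻ r))
        (R.trans {to (to⁻ r)} {to (to⁻ s)} {s} (Bijection.cong members≃ℝ {to⁻ r} {to⁻ s} eq) (to∘to⁻ s))
        where open Bijection members≃ℝ using (to; to⁻)
              to∘to⁻ = λ y → proj₂ (Bijection.surjective members≃ℝ y) {to⁻ y} ≈-refl

    private
      X≃ℝ = members≃ℝ borel-full proper

    -- The whole group is Borel and outside `𝓘`, so it is equipotent with ℝ; `ψ` and `φ` are the two
    -- directions, read on classes.
    ψ : W → ℝ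
    ψ w = Bijection.to X≃ℝ (e w , tt , λ ())

    φ : ℝ → W
    φ r = [ member borel-full proper r ]

    ψ-injective : ∀ {v w} → ψ v R.≈ ψ w → v ≡ w
    ψ-injective {v} {w} eq = repr-injective (Bijection.injective X≃ℝ {e v , tt , λ ()} {e w , tt , λ ()} eq)

    ψ-φ : ∀ r → ψ (φ r) R.≈ r
    ψ-φ r = proj₂ (Bijection.surjective X≃ℝ r) (repr-[] _)

    ψ-cong : ∀ {v w} → v ≡ w → ψ v R.≈ ψ w
    ψ-cong {v} refl = R.refl {ψ v}

    φ-cong : ∀ {r s} → r R.≈ s → φ r ≡ φ s
    φ-cong {r} {s} eq = ψ-injective (R.trans {ψ (φ r)} {r} {ψ (φ s)} (ψ-φ r)
      (R.trans {r} {s} {ψ (φ s)} eq (R.sym {ψ (φ s)} {s} (ψ-φ s))))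

    φ-injective : ∀ {r s} → φ r ≡ φ s → r R.≈ s
    φ-injective {r} {s} eq = R.trans {r} {ψ (φ r)} {s} (R.sym {ψ (φ r)} {r} (ψ-φ r))
      (R.trans {ψ (φ r)} {ψ (φ s)} {s} (ψ-cong eq) (ψ-φ s))

    φ-ψ : ∀ w → φ (ψ w) ≡ w
    φ-ψ w = ψ-injective (ψ-φ (ψ w))

    w₀ : W
    w₀ = [ 0# ]

    small-by-contra : (∀ (f : S → W) → ¬ (∀ w → ∃ λ s → f s ≡ w)) → Small W S
    small-by-contra ¬onto f = by-contra λ none →
      ¬onto f λ w → by-contra λ ¬hit → none (w , λ s eq → ¬hit (s , eq))

    ℕ-small : Small W ℕ
    ℕ-small = small-by-contra λ f onto → uncountable (record
      { to        = λ x → proj₁ (onto [ x ])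
      ; cong      = λ x≈y → cong (proj₁ ∘ onto) ([]-cong x≈y)
      ; injective = λ {x} {y} eq → []-injective
          (trans (sym (proj₂ (onto [ x ]))) (trans (cong f eq) (proj₂ (onto [ y ]))))
      })

    pow : ∀ {K : Set} → K ↣ W → Small W K → (K → Bool) ↣ W
    pow {K} i small = mk↣ {to = λ s → φ (Injection.to 2^K≲ℝ (fn s))} λ eq →
      ext (Injection.injective 2^K≲ℝ (φ-injective eq))
      where
        fn : (K → Bool) → Func (≡-setoid K) (≡-setoid Bool)
        fn s = record { to = s ; cong = cong s }

        K≺ℝ : ≡-setoid K ≺ ℝ-setoid
        K≺ℝ = record
          { to        = λ k → ψ (i $↣ k)
          ; cong      = λ eq → ψ-cong (cong (i $↣_) eq)
          ; injective = λ eq → ↣-injective i (ψ-injective eq)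
          } , λ j →
            -- An injection of ℝ into `K` has a left inverse mapping `K` onto `W`, contrary to
            -- smallness.
            let W↣K = mk↣ {to = λ w → Injection.to j (ψ w)} λ eq → ψ-injective (Injection.injective j eq)
                (w , missed) = small (extend W↣K w₀ id)
            in missed (W↣K $↣ w) (extend-to W↣K w₀ id w)

        2^K≲ℝ : 2^ (≡-setoid K) ≲ ℝ-setoid
        2^K≲ℝ = 2^<𝔠≤𝔠 (≡-setoid K) K≺ℝ

    -- The Cauchy sequence underlying `ψ w` determines the real number, and so determines `w`.
    digits : W ↣ (ℕ → ℚ)
    digits = mk↣ {to = λ w → seq (ψ w)} λ {v} {w} eq → ψ-injective (seq-≈ {ψ v} {ψ w} eq)
      where
        seq-≈ : ∀ {r s} → seq r ≡ seq s → r R.≈ s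
        seq-≈ {mkℝ u p} {mkℝ _ _} refl = R.refl {mkℝ u p}

    opaque
      arithmetic : Arithmetic W
      arithmetic = Continuum.arithmetic W w₀ ℕ-small pow digits

    open Arithmetic arithmetic

    opaque
      another : ∀ (w : W) → ∃ λ (v : W) → w ≢ v
      another w = let (v , w≢) = small-countable ⊤↣ℕ (λ _ → w) in v , w≢ tt

    open WellOrder order

    seg : W → W → Bool
    seg = segment order

    seg-small : ∀ w → Small W (Sub (seg w))
    seg-small = segment-small

    -- 𝔠 is regular.
    bounded : ∀ (P : W → Bool) → Small W (Sub P) → ∃ λ α → ∀ {w} → T (P w) → w < α
    bounded P small =
      -- The closed segments up to elements of `P` have a small union; any `α` outside it lies above
      -- all of `P`.
      map₂ below (small-Σ (Sub-↣ P) small (λ (w , _) → small-insert w (seg-small w)) (λ (_ , v , _) → v))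
      where
        below : ∀ {α} → (∀ (s : Σ (Sub P) λ (w , _) → Sub (insert w (seg w))) → proj₁ (proj₂ s) ≢ α) →
                ∀ {w} → T (P w) → w < α
        below {α} ≢α {w} p with compare w α
        ... | inj₁ w<α         = w<α
        ... | inj₂ (inj₁ refl) = ⊥-elim (≢α ((w , p) , w , Equivalence.from (T-∨ {seg w w}) (inj₂ (truth⁺ refl))) refl)
        ... | inj₂ (inj₂ α<w)  = ⊥-elim (≢α ((w , p) , α , Equivalence.from T-∨ (inj₁ α<w)) refl)

    small-subset : ∀ (F : Subset setoid) → ⟦ F ⟧ ≺ ℝ-setoid → Small W (Sub λ (w : W) → truth (e w ∈ F))
    small-subset F (_ , ¬ℝ≲F) = small-by-contra λ f onto → ¬ℝ≲F (record
      { to        = λ r → let ((w , p) , _) = onto (φ r) in e w , truth⁻ p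
      ; cong      = λ r≈s → Setoid.reflexive setoid (cong (e ∘ proj₁ ∘ proj₁ ∘ onto) (φ-cong r≈s))
      ; injective = λ {r} {s} eq → φ-injective
          (trans (sym (proj₂ (onto (φ r))))
            (trans (cong f (Sub-≡ (repr-injective eq))) (proj₂ (onto (φ s)))))
      })

    -- `ι` lists 𝔠 members of `A` by their classes. Followed by a left inverse of `ι`, the map `f`
    -- misses some index `w`, so it misses the member at `w`.
    avoid : ∀ {A} → Borel X A → ¬ 𝓘 A → Small W S → (f : S → Carrier) →
            ∃ λ a → a ∈ A × (∀ s → ¬ (f s ≈ a))
    avoid {A = A} borel-A A∉𝓘 small f =
      let (w , missed) = small (extend ι w₀ id ∘ [_] ∘ f)
      in point w , member-∈ borel-A A∉𝓘 (ψ w) , λ s fs≈ →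
           missed s (trans (cong (extend ι w₀ id) ([]-cong fs≈)) (extend-to ι w₀ id w))
      where
        point : W → Carrier
        point w = member borel-A A∉𝓘 (ψ w)

        ι : W ↣ W
        ι = mk↣ {to = [_] ∘ point} λ eq → ψ-injective (member-injective borel-A A∉𝓘 ([]-injective eq))

    -- Enumeration of the requests in type 𝔠.

    encode : Code → W
    encode (balls s) = sequences $↣ λ where
      zero    → ℕ↣W $↣ 0
      (suc _) → families $↣ s
    encode (nor cs) = sequences $↣ λ where
      zero    → ℕ↣W $↣ 1
      (suc n) → encode (cs n)

    -- Entry 0 of the coded sequence is a constructor tag; the entries after it hold the data, a
    -- ball family being repeated in all of them.
    encode-injective : ∀ c c′ → encode c ≡ encode c′ → c ≡ c′
    encode-injective (balls s) (balls t) eq =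
      cong balls (↣-injective families (cong (λ f → f 1) (↣-injective sequences eq)))
    encode-injective (balls s) (nor cs) eq =
      case ↣-injective ℕ↣W (cong (λ f → f 0) (↣-injective sequences eq)) of λ ()
    encode-injective (nor cs) (balls s) eq =
      case ↣-injective ℕ↣W (cong (λ f → f 0) (↣-injective sequences eq)) of λ ()
    encode-injective (nor cs) (nor cs′) eq =
      cong nor (ext λ n → encode-injective (cs n) (cs′ n) (cong (λ f → f (suc n)) (↣-injective sequences eq)))

    BigBorel : Set _
    BigBorel = ∃ λ A → Borel X A × ¬ 𝓘 A

    full-big : BigBorel
    full-big = full setoid , borel-full , proper

    -- Borel sets form a large type, so requests range over codes. A code matched by no Borel set
    -- outside `𝓘` falls back to the whole group.
    realise : Code → BigBorel
    realise c with em {P = ∃ λ ((A , _) : BigBorel) → A ≐ ⟪ c ⟫}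
    ... | yes (B , _) = B
    ... | no _        = full-big

    realise-⊆ : ∀ {A} → ¬ 𝓘 A → (borel-A : Borel X A) → proj₁ (realise (proj₁ (borel-code borel-A))) ⊆ A
    realise-⊆ {A} A∉𝓘 borel-A with borel-code borel-A
    ... | c , A⊆c , c⊆A with em {P = ∃ λ ((A , _) : BigBorel) → A ≐ ⟪ c ⟫}
    ...   | yes (_ , B⊆c , _) = λ x∈B → c⊆A (B⊆c x∈B)
    ...   | no none = ⊥-elim (none ((A , borel-A , A∉𝓘) , A⊆c , c⊆A))

    codes : (W × Code) ↣ W
    codes = pairs ↣-∘ mk↣ {to = map₂ encode} λ {(_ , c)} {(_ , c′)} eq →
      cong₂ _,_ (cong proj₁ eq) (encode-injective c c′ (cong proj₂ eq))

    opaque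
      -- Stages that code no pair serve the harmless request for the whole group.
      request : W → W × BigBorel
      request = extend codes (w₀ , full-big) (map₂ realise)

      request-codes : ∀ p → request (codes $↣ p) ≡ map₂ realise p
      request-codes = extend-to codes (w₀ , full-big) (map₂ realise)

    label : W → W
    label α = proj₁ (request α)

    target : W → Subset setoid
    target α = proj₁ (proj₂ (request α))

    requested : ∀ ξ {A} → Borel X A → ¬ 𝓘 A → ∃ λ α → label α ≡ ξ × target α ⊆ A
    requested ξ {A} borel-A A∉𝓘 = codes $↣ (ξ , c) , cong proj₁ eq ,
      λ {x} → subst (λ B → x ∈ B → x ∈ A) (sym (cong (proj₁ ∘ proj₂) eq)) (realise-⊆ A∉𝓘 borel-A)
      where
        c = proj₁ (borel-code borel-A)
        eq = request-codes (ξ , c)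

    -- The labels ξ for which B_ξ receives a point at stage α.
    active : W → W → Bool
    active α = insert (label α) (seg α)

    active-small : ∀ α → Small W (Sub (active α))
    active-small α = small-insert (label α) (seg-small α)

    active-label : ∀ α → T (active α (label α))
    active-label α = Equivalence.from (T-∨ {seg α (label α)}) (inj₂ (truth⁺ refl))

    active-< : ∀ {α ξ} → ξ < α → T (active α ξ)
    active-< ξ<α = Equivalence.from T-∨ (inj₁ ξ<α)

    -- Choice of the translations.

    c : Carrier
    c = e (proj₁ (another [ 0# ]))

    c≉0 : ¬ (c ≈ 0#)
    c≉0 c≈0 = proj₂ (another [ 0# ]) (trans (sym ([]-cong c≈0)) ([]-repr _))

    -- The forbidden differences between points of distinct stages: 0 for disjointness, and c with
    -- both signs because either of two points may belong to the later stage.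
    shift : Fin 3 → Carrier
    shift zero             = 0#
    shift (suc zero)       = c
    shift (suc (suc zero)) = - c

    opposite : Fin 3 → Fin 3
    opposite zero             = zero
    opposite (suc zero)       = suc (suc zero)
    opposite (suc (suc zero)) = suc zero

    open AbelianGroup abelianGroup
      using (∙-cong; ∙-congˡ; ∙-congʳ; assoc; comm; identityˡ; identityʳ; inverseˡ; inverseʳ)
    private
      module G = GroupProperties abelianGroup
      open ≈-Reasoning setoid

    shift-opposite : ∀ k → shift k + shift (opposite k) ≈ 0#
    shift-opposite zero             = identityˡ 0#
    shift-opposite (suc zero)       = inverseʳ c
    shift-opposite (suc (suc zero)) = inverseˡ c

    module _ (α : W) (t : Sub (seg α) → Carrier) where
      Obstacle : Set
      Obstacle = Σ (Sub (seg α)) λ (β , _) → Sub (active β) × Sub (active α) × Fin 3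

      obstacle-small : Small W Obstacle
      obstacle-small = small-Σ (Sub-↣ _) (seg-small α) λ (β , _) →
        small-Σ (Sub-↣ _) (active-small β) λ _ →
        small-Σ (Sub-↣ _) (active-small α) λ _ → small-countable (Fin↣ℕ 3)

      -- The one value of `a` for which the translation `a - e (label α)` would carry `e x` to
      -- `e y + t s + shift k`.
      obstacle : Obstacle → Carrier
      obstacle (s@(β , _) , (y , _) , (x , _) , k) = (e y + t s + shift k + - e x) + e (label α)

      opaque
        goal : ∃ λ a → a ∈ target α × (∀ s → ¬ (obstacle s ≈ a))
        goal = let (_ , borel , big) = proj₂ (request α) in avoid borel big obstacle-small obstacle

        translation : Carrier
        translation = proj₁ goal + - e (label α)

        hits : e (label α) + translation ∈ target α
        hits = resp (target α) (≈-sym (≈-trans (comm _ _) (G.//-rightDividesˡ _ _))) (proj₁ (proj₂ goal))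

        misses : ∀ s {x y k} → T (active (proj₁ s) y) → T (active α x) →
                 ¬ (e x + translation ≈ e y + t s + shift k)
        misses s {x} {y} {k} y∈ x∈ eq = proj₂ (proj₂ goal) (s , (y , y∈) , (x , x∈) , k) (begin
          (e y + t s + shift k + - e x) + l  ≈⟨ ∙-congʳ (∙-congʳ eq) ⟨
          (e x + translation + - e x) + l    ≈⟨ ∙-congʳ (G.xyx⁻¹≈y (e x) translation) ⟩
          (proj₁ goal + - l) + l             ≈⟨ G.//-rightDividesˡ l (proj₁ goal) ⟩
          proj₁ goal                        ∎)
          where
            l : Carrier
            l = e (label α)

    stage : ∀ α → (∀ {β} → β < α → Carrier) → Carrier
    stage α t = translation α λ (_ , β<α) → t β<α

    opaque
      τ : W → Carrier
      τ = All.wfRec wf 0ℓ (λ _ → Carrier) stage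

      τ-unfold : ∀ α → τ α ≡ translation α (τ ∘ proj₁)
      τ-unfold α = FixPoint.unfold-wfRec wf (λ _ → Carrier) stage
        (λ α′ eq → cong (translation α′) (ext λ (_ , β<α) → eq β<α))

      τ-hits : ∀ α → e (label α) + τ α ∈ target α
      τ-hits α = subst (λ t → e (label α) + t ∈ target α) (sym (τ-unfold α)) (hits α (τ ∘ proj₁))

      τ-misses : ∀ {α β x y} k → β < α → T (active α x) → T (active β y) →
                 ¬ (e x + τ α ≈ e y + τ β + shift k)
      τ-misses {α} {β} {x} {y} k β<α x∈ y∈ eq =
        misses α (τ ∘ proj₁) (β , β<α) {k = k} y∈ x∈ (subst (λ t → e x + t ≈ e y + τ β + shift k) (τ-unfold α) eq)

    -- If the stages differ, the later one has excluded the coincidence; when that is `β`, the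
    -- equation is first turned round with the opposite shift.
    same-stage : ∀ {α β x y} k → T (active α x) → T (active β y) →
                 e x + τ α ≈ e y + τ β + shift k → α ≡ β
    same-stage {α} {β} {x} {y} k x∈ y∈ eq with compare α β
    ... | inj₂ (inj₁ α≡β) = α≡β
    ... | inj₂ (inj₂ β<α) = ⊥-elim (τ-misses k β<α x∈ y∈ eq)
    ... | inj₁ α<β        = ⊥-elim (τ-misses (opposite k) α<β y∈ x∈ (begin
      e y + τ β                                    ≈⟨ identityʳ _ ⟨
      e y + τ β + 0#                               ≈⟨ ∙-congˡ (shift-opposite k) ⟨
      e y + τ β + (shift k + shift (opposite k))   ≈⟨ assoc _ _ _ ⟨
      e y + τ β + shift k + shift (opposite k)     ≈⟨ ∙-congʳ eq ⟨
      e x + τ α + shift (opposite k)               ∎))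

    -- Shift 0 makes the stages equal, and their common translation cancels.
    same-label : ∀ {α β x y} → T (active α x) → T (active β y) → e x + τ α ≈ e y + τ β → x ≡ y
    same-label {α} x∈ y∈ eq with refl ← same-stage zero x∈ y∈ (≈-trans eq (≈-sym (identityʳ _))) =
      repr-injective (G.∙-cancelʳ (τ α) _ _ eq)

    -- The pieces: disjointness and failure of 2-covering.

    piece : W → Subset setoid
    pred (piece ξ) z = ∃ λ α → T (active α ξ) × z ≈ e ξ + τ α
    resp (piece ξ) y≈z (α , ξ∈ , y≈) = α , ξ∈ , ≈-trans (≈-sym y≈z) y≈

    piece-disjoint : ∀ {ξ η z} → z ∈ piece ξ → z ∈ piece η → ξ ≡ η
    piece-disjoint (_ , ξ∈ , z≈) (_ , η∈ , z≈′) = same-label ξ∈ η∈ (≈-trans (≈-sym z≈) z≈′)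

    -- A translate of {0, c} inside one piece would come from a single stage.
    piece-¬2-covering : ∀ ξ → ¬ Is2Covering X (piece ξ)
    piece-¬2-covering ξ covering =
      let (x , ⊆piece)    = covering 0,c 0,c≃2
          (α , ξ∈α , 0+x≈) = ⊆piece (0# , inj₁ ≈-refl , ≈-refl)
          (β , ξ∈β , c+x≈) = ⊆piece (c , inj₂ ≈-refl , ≈-refl)
          eq = begin
            e ξ + τ β            ≈⟨ c+x≈ ⟨
            c + x                ≈⟨ comm c x ⟩
            x + c                ≈⟨ ∙-congʳ (≈-trans (≈-sym (identityˡ x)) 0+x≈) ⟩
            e ξ + τ α + c        ∎
      in clash α β ξ∈α ξ∈β eq
      where
        clash : ∀ α β → T (active α ξ) → T (active β ξ) → ¬ (e ξ + τ β ≈ e ξ + τ α + c)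
        clash α β ξ∈α ξ∈β eq with refl ← same-stage (suc zero) ξ∈β ξ∈α eq =
          c≉0 (≈-sym (G.∙-cancelˡ (e ξ + τ α) 0# c (≈-trans (identityʳ _) eq)))

        0,c : Subset setoid
        pred 0,c z = z ≈ 0# ⊎ z ≈ c
        resp 0,c y≈z (inj₁ y≈0) = inj₁ (≈-trans (≈-sym y≈z) y≈0)
        resp 0,c y≈z (inj₂ y≈c) = inj₂ (≈-trans (≈-sym y≈z) y≈c)

        to : Setoid.Carrier ⟦ 0,c ⟧ → Fin 2
        to (_ , inj₁ _) = zero
        to (_ , inj₂ _) = suc zero

        0,c≃2 : ⟦ 0,c ⟧ ≃ ≡-setoid (Fin 2)
        0,c≃2 = record
          { to = to
          ; cong = λ {y} {z} → to-cong {y} {z}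
          ; bijective = (λ {y} {z} → to-injective {y} {z}) , λ where
              zero       → (0# , inj₁ ≈-refl) , λ {z} → to-cong {z} {0# , inj₁ ≈-refl}
              (suc zero) → (c , inj₂ ≈-refl) , λ {z} → to-cong {z} {c , inj₂ ≈-refl}
          }
          where
            to-cong : ∀ {y z} → proj₁ y ≈ proj₁ z → to y ≡ to z
            to-cong {_ , inj₁ _}   {_ , inj₁ _}   _   = refl
            to-cong {_ , inj₂ _}   {_ , inj₂ _}   _   = refl
            to-cong {_ , inj₁ y≈0} {_ , inj₂ z≈c} y≈z =
              ⊥-elim (c≉0 (≈-trans (≈-sym z≈c) (≈-trans (≈-sym y≈z) y≈0)))
            to-cong {_ , inj₂ y≈c} {_ , inj₁ z≈0} y≈z =
              ⊥-elim (c≉0 (≈-trans (≈-sym y≈c) (≈-trans y≈z z≈0)))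

            to-injective : ∀ {y z} → to y ≡ to z → proj₁ y ≈ proj₁ z
            to-injective {_ , inj₁ y≈} {_ , inj₁ z≈} _ = ≈-trans y≈ (≈-sym z≈)
            to-injective {_ , inj₂ y≈} {_ , inj₂ z≈} _ = ≈-trans y≈ (≈-sym z≈)

    -- Complete nonmeasurability.

    piece-meets : ∀ ξ {A} → Borel X A → ¬ 𝓘 A → ∃ λ z → z ∈ A × z ∈ piece ξ
    piece-meets ξ borel-A A∉𝓘 =
      let (α , label≡ξ , target⊆A) = requested ξ borel-A A∉𝓘
      in e ξ + τ α ,
         target⊆A (subst (λ η → e η + τ α ∈ target α) label≡ξ (τ-hits α)) ,
         α , subst (T ∘ active α) label≡ξ (active-label α) , ≈-refl

    𝓘-∪ : ∀ {A B C} → (∀ {x} → x ∈ A → x ∈ B ⊎ x ∈ C) → 𝓘 B → 𝓘 C → 𝓘 A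
    𝓘-∪ {A} {B} {C} A⊆B∪C B∈𝓘 C∈𝓘 = downward
      (λ x∈A → [ (λ x∈B → 0 , x∈B) , (λ x∈C → 1 , x∈C) ]′ (A⊆B∪C x∈A))
      (unions parts λ { zero → B∈𝓘 ; (suc _) → C∈𝓘 })
      where
        parts : ℕ → Subset setoid
        parts zero    = B
        parts (suc _) = C

    -- If a Borel set `D` in `𝓘` covered the intersection, then `A` minus `D` would still be Borel
    -- and outside `𝓘`, so the piece would meet it at a point that `D` has to contain.
    piece-∩∉𝓘 : ∀ ξ {A} → Borel X A → ¬ 𝓘 A → ¬ 𝓘 (A ∩ piece ξ)
    piece-∩∉𝓘 ξ {A} borel-A A∉𝓘 A∩∈𝓘 =
      let (D , borel-D , D∈𝓘 , A∩⊆D) = borel-base (A ∩ piece ξ) A∩∈𝓘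
          (_ , (z∈A , z∉D) , z∈piece) = piece-meets ξ (borel-∖ borel-A borel-D) λ A∖D∈𝓘 →
            A∉𝓘 (𝓘-∪ {A} {D} {A ∖ D} (λ {x} x∈A → case em {P = x ∈ D} of λ where
              (yes x∈D) → inj₁ x∈D
              (no x∉D)  → inj₂ (x∈A , x∉D)) D∈𝓘 A∖D∈𝓘)
      in z∉D (A∩⊆D (z∈A , z∈piece))

    -- By disjointness, what `piece ξ` leaves of `A` contains the part of `A` in any other piece,
    -- which is not in `𝓘`.
    piece-nonmeasurable : ∀ ξ → CompletelyNonmeasurable X 𝓘 (piece ξ)
    piece-nonmeasurable ξ A borel-A A∉𝓘 = piece-∩∉𝓘 ξ borel-A A∉𝓘 , λ A∖∈𝓘 →
      let (η , ξ≢η) = another ξ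
      in piece-∩∉𝓘 η borel-A A∉𝓘 (downward
           (λ (x∈A , x∈η) → x∈A , λ x∈ξ → ξ≢η (piece-disjoint x∈ξ x∈η)) A∖∈𝓘)

    -- The family indexed by ℝ and its S-covering property.

    pieces : Family ℝ-setoid setoid
    pieces = record
      { to   = piece ∘ φ
      ; cong = λ r≈s → (λ {x} → subst (λ ξ → x ∈ piece ξ) (φ-cong r≈s)) ,
                       (λ {x} → subst (λ ξ → x ∈ piece ξ) (sym (φ-cong r≈s)))
      }

    pieces-disjoint : PairwiseDisjoint pieces
    pieces-disjoint r s r≉s x (x∈r , x∈s) = r≉s (φ-injective (piece-disjoint x∈r x∈s))

    pieces-S-covering : IsSCovering X ℝ-setoid pieces
    pieces-S-covering = pieces-disjoint , λ F F≺ℝ →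
      -- Every class of a point of `F` lies below `α` and is active there, so `τ α` sends each such
      -- point into the piece labelled by its own class.
      let (α , F<α) = bounded _ (small-subset F F≺ℝ)

          active-F : ∀ {x} → x ∈ F → T (active α [ x ])
          active-F x∈F = active-< (F<α (truth⁺ (resp F (≈-sym (repr-[] _)) x∈F)))

          position : ∀ {x z} → z ≈ x + τ α → z ≈ e [ x ] + τ α
          position z≈ = ≈-trans z≈ (∙-congʳ (≈-sym (repr-[] _)))

          in-piece : ∀ {z} → z ∈ translate X F (τ α) → ∃ λ x → z ≈ x + τ α × z ∈ piece [ x ]
          in-piece (x , x∈F , z≈) = x , z≈ , α , active-F x∈F , position z≈

          unique : ∀ {y z ξ} → y ∈ translate X F (τ α) → z ∈ translate X F (τ α) →
                   y ∈ piece ξ → z ∈ piece ξ → y ≈ z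
          unique y∈F z∈F y∈ξ z∈ξ =
            let (x , y≈ , y∈x) = in-piece y∈F
                (x′ , z≈ , z∈x′) = in-piece z∈F
                x≈x′ = []-injective (trans (piece-disjoint y∈x y∈ξ) (piece-disjoint z∈ξ z∈x′))
            in ≈-trans y≈ (≈-trans (∙-congʳ x≈x′) (≈-sym z≈))
      in τ α ,
         (λ z∈ → let (x , _ , z∈x) = in-piece z∈
                 in ψ [ x ] , subst (λ ξ → _ ∈ piece ξ) (sym (φ-ψ [ x ])) z∈x) ,
         λ j → record
           { to        = λ _ → zero
           ; cong      = λ _ → refl
           ; injective = λ {(_ , y∈F , y∈j)} {(_ , z∈F , z∈j)} _ → unique y∈F z∈F y∈j z∈j
           }

    decomposition : Σ (Family ℝ-setoid setoid) λ B →
      PairwiseDisjoint B ×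
      (∀ ξ → CompletelyNonmeasurable X 𝓘 (B ⟨$⟩ ξ)) ×
      (∀ ξ → ¬ Is2Covering X (B ⟨$⟩ ξ)) ×
      IsSCovering X ℝ-setoid B
    decomposition = pieces , pieces-disjoint , (λ r → piece-nonmeasurable (φ r)) ,
      (λ r → piece-¬2-covering (φ r)) , pieces-S-covering

mainTheorem13 :
  (∀ {ℓ} → ExcludedMiddle ℓ) →
  (∀ {a b} → Extensionality a b) →
  ∀ {i} (X : AbelianPolishGroup) →
  let open AbelianPolishGroup X in
  ¬ Countable setoid →
  (𝓘 : Pred (Subset setoid) i) →
  IsSigmaIdeal X 𝓘 →
  Proper X 𝓘 →
  TranslationInvariant X 𝓘 →
  ContainsSingletons X 𝓘 →
  HasBorelBase X 𝓘 →
  (∀ B → Borel X B → ¬ 𝓘 B →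
    ∀ (K : Setoid 0ℓ 0ℓ) → K ≺ ℝ-setoid →
    ∀ (𝓓 : Family K setoid) → (∀ k → 𝓘 (𝓓 ⟨$⟩ k)) →
    ⟦ B ∖ ⋃ᶠ 𝓓 ⟧ ≃ ℝ-setoid) →
  (∃[ a ] (∃[ x ] ∃[ y ] d x y ≈ᴿ a) × ¬ (a ≈ᴿ 0ᴿ) × (∀ x → 𝓘 (sphere X x a))) →
  (∀ (K : Setoid 0ℓ 0ℓ) → K ≺ ℝ-setoid → 2^ K ≲ ℝ-setoid) →
  Σ (Family ℝ-setoid setoid) λ B →
    PairwiseDisjoint B ×
    (∀ ξ → CompletelyNonmeasurable X 𝓘 (B ⟨$⟩ ξ)) ×
    (∀ ξ → ¬ Is2Covering X (B ⟨$⟩ ξ)) ×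
    IsSCovering X ℝ-setoid B
mainTheorem13 em ext X uncountable 𝓘 σ-ideal proper _ _ borel-base large _ 2^<𝔠≤𝔠 =
  Classical.Construction.decomposition em ext X uncountable 𝓘 σ-ideal proper borel-base large 2^<𝔠≤𝔠
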